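{- Let $G$ be a finite simple undirected graph that is AT-free, and let $\chi(G)$ be its chromatic number. Then $\mathrm{box}(G) \le \chi(G)$.
   Context: An asteroidal triple in $G$ is an independent set of three vertices such that between each pair of them there is a path avoiding the (open) neighbourhood of the third; $G$ is AT-free if it has no asteroidal triple. The boxicity $\mathrm{box}(G)$ is the minimum integer $k$ such that $G$ is the intersection graph of a family of axis-parallel $k$-dimensional boxes (Cartesian products $R_1\times\cdots\times R_k$ of closed real intervals), equivalently the minimum $k$ such that $G = I_1\cap\cdots\cap I_k$ for interval graphs $I_j$ on vertex set $V(G)$ (intersection meaning same vertex set and intersection of edge sets). -}

module Defs where

open import Level using (0ℓ)
open import Data.Nat using (ℕ; _≤_)
open import Data.Fin using (Fin)
open import Data.Product using (Σ; _×_; ∃)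
open import Relation.Nullary using (¬_; Dec)
open import Relation.Binary.PropositionalEquality using (_≡_; _≢_)

record SimpleGraph (n : ℕ) : Set₁ where
  field
    Adj    : Fin n → Fin n → Set
    sym    : ∀ {u v} → Adj u v → Adj v u
    irrefl : ∀ {u} → ¬ Adj u u
    dec    : ∀ u v → Dec (Adj u v)
open SimpleGraph public

module _ {n : ℕ} (G : SimpleGraph n) where

  data PathAvoiding (z : Fin n) : Fin n → Fin n → Set where
    here : ∀ {x} → ¬ Adj G z x → PathAvoiding z x x
    step : ∀ {x y w} → ¬ Adj G z x → Adj G x y → PathAvoiding z y w → PathAvoiding z x w

  Independent3 : Fin n → Fin n → Fin n → Set
  Independent3 x y z =
    x ≢ y × y ≢ z × x ≢ z ×
    ¬ Adj G x y × ¬ Adj G y z × ¬ Adj G x z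

  AsteroidalTriple : Fin n → Fin n → Fin n → Set
  AsteroidalTriple x y z =
    Independent3 x y z ×
    PathAvoiding z x y × PathAvoiding x y z × PathAvoiding y x z

  ATFree : Set
  ATFree = ∀ x y z → ¬ AsteroidalTriple x y z

  ProperColouring : (k : ℕ) → (Fin n → Fin k) → Set
  ProperColouring k c = ∀ u v → Adj G u v → c u ≢ c v

  Colourable : ℕ → Set
  Colourable k = Σ (Fin n → Fin k) (ProperColouring k)

  IsChromaticNumber : ℕ → Set
  IsChromaticNumber k = Colourable k × (∀ m → Colourable m → k ≤ m)

record Interval : Set where
  constructor [_,_]⟨_⟩
  field
    lo    : ℕ
    hi    : ℕ
    lo≤hi : lo ≤ hi
open Interval public

_∈I_ : ℕ → Interval → Set
x ∈I I = lo I ≤ x × x ≤ hi I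

Box : ℕ → Set
Box d = Fin d → Interval

_∈B_ : {d : ℕ} → (Fin d → ℕ) → Box d → Set
p ∈B B = ∀ j → p j ∈I B j

BoxesIntersect : {d : ℕ} → Box d → Box d → Set
BoxesIntersect {d} B C = ∃ λ (p : Fin d → ℕ) → p ∈B B × p ∈B C

IsBoxRepresentation : {n : ℕ} → SimpleGraph n → (d : ℕ) → (Fin n → Box d) → Set
IsBoxRepresentation {n} G d f =
  ∀ (u v : Fin n) → u ≢ v → (Adj G u v → BoxesIntersect (f u) (f v)) × (BoxesIntersect (f u) (f v) → Adj G u v)

HasBoxRepresentation : {n : ℕ} → SimpleGraph n → ℕ → Set
HasBoxRepresentation G d = Σ _ (IsBoxRepresentation G d)

{-# OPTIONS --safe #-}

-- Fix a proper colouring with χ colours.  It suffices to find, for every colour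
-- class S, an interval supergraph of G in which each vertex of S keeps exactly
-- its G-neighbours: every non-edge of G meets some class, so the intersection of
-- these χ supergraphs is G.
--
-- For an independent set S write C y x z if some path from x to z avoids N(y).
-- AT-freeness yields a linear order of S such that x < y < z implies ¬ C y x z.
-- Given that order, put the i-th vertex of S at the point 2i + 1; a vertex v
-- outside S either is adjacent to y ∈ S or lies on one side of y, according to
-- the elements of S in its component of G − N[y], and v receives the interval
-- between the points to its left and the points to its right.
--
-- Call e admissible in S if there are no x, z ∈ S with C x e z and C z e x.
-- The order is built from an admissible first element e, by repeatedly choosing
-- y ∈ S ∖ e that separates e from the rest of S and is admissible in S ∖ e.

module Submission where

open import Defs
open import Data.Empty using (⊥; ⊥-elim)
open import Data.Fin as Fin using (Fin; zero; suc; toℕ)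
open import Data.Fin.Properties as Fin using (any?; toℕ-fromℕ<; toℕ-injective)
open import Data.List using (List; []; _∷_; _++_; length; lookup; filter; allFin)
open import Data.List.Membership.Propositional using (_∈_)
open import Data.List.Membership.Propositional.Properties using (∈-filter⁺; ∈-filter⁻; ∈-++⁺ˡ; ∈-++⁺ʳ; ∈-++⁻; ∈-allFin; ∈-lookup)
open import Data.List.Properties using (filter-notAll; length-filter)
open import Data.List.Relation.Unary.All as All using (All; []; _∷_)
open import Data.List.Relation.Unary.AllPairs using (AllPairs; []; _∷_)
open import Data.List.Relation.Unary.Any as Any using (here; there; index)
open import Data.List.Relation.Unary.Any.Properties using (lookup-index)
open import Data.Nat using (ℕ; zero; suc; _+_; _*_; _≤_; _<_; _⊔_; z≤n; s≤s; z<s; s<s; s<s⁻¹; s≤s⁻¹)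
open import Data.Nat.Properties
open import Data.Product using (Σ; ∃; _×_; _,_; proj₁; proj₂; swap)
open import Data.Sum as Sum using (_⊎_; inj₁; inj₂; [_,_]′)
open import Data.Unit using (⊤)
open import Function using (_∘_; flip; id)
open import Relation.Binary.Definitions using (DecidableEquality; Transitive) renaming (Decidable to Decidable₂)
open import Relation.Binary.PropositionalEquality using (_≡_; _≢_; refl; cong; subst; trans) renaming (sym to ≡-sym)
open import Relation.Nullary using (¬_; Dec; yes; no; contradiction)
open import Relation.Nullary.Decidable using (map′; ¬?; _×-dec_; _⊎-dec_; decidable-stable)
open import Relation.Unary using (Decidable)

-- Minimal elements of finite strict orders

minimal : {A : Set} {_⊏_ : A → A → Set} → Decidable₂ _⊏_ → Transitive _⊏_ → (∀ {x} → ¬ x ⊏ x) →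
          ∀ {a} xs → a ∈ xs → ∃ λ m → m ∈ xs × (∀ {x} → x ∈ xs → ¬ x ⊏ m)
minimal _⊏?_ ⊏-trans ⊏-irrefl (y ∷ []) _ = y , here refl , λ { (here refl) → ⊏-irrefl }
minimal _⊏?_ ⊏-trans ⊏-irrefl (y ∷ xs@(_ ∷ _)) _
  with minimal _⊏?_ ⊏-trans ⊏-irrefl xs (here refl)
... | m , m∈xs , m-min with y ⊏? m
...   | yes y⊏m = y , here refl , λ
        { (here refl) → ⊏-irrefl
        ; (there x∈xs) x⊏y → m-min x∈xs (⊏-trans x⊏y y⊏m) }
...   | no y⋢m = m , there m∈xs , λ
        { (here refl) → y⋢m
        ; (there x∈xs) → m-min x∈xs }

-- Convex orders

module Separation
  {A : Set} (_≟_ : DecidableEquality A)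
  (C : A → A → A → Set) (C? : ∀ y x z → Dec (C y x z))
  (C-refl : ∀ {y x} → C y x x)
  (C-sym : ∀ {y x z} → C y x z → C y z x)
  (C-trans : ∀ {y x w z} → C y x w → C y w z → C y x z)
  (C-self : ∀ {y z} → C y y z → z ≡ y)
  (C-reroute : ∀ {y x z} w → C y x z → C w x z ⊎ C y x w)
  (C-noAT : ∀ {x y z} → C x y z → C y x z → C z x y → x ≡ y)
  where

  -- A path from `x` that met the neighbourhood of `w` could be continued to `w`, although `y`
  -- separates `x` from `w`.
  reroute-via : ∀ {y x z w} → ¬ C y x w → C y x z → C w x z
  reroute-via {w = w} ¬c c = [ id , (λ c′ → contradiction c′ ¬c) ]′ (C-reroute w c)

  -- The case `x ≡ e` only lets through the trivial instance: `C-self` then makes `z` equal to `e`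
  -- too.
  Admissible : List A → A → Set
  Admissible S e = ∀ {x z} → x ∈ S → z ∈ S → C x e z → C z e x → x ≡ e

  Closer : A → A → A → Set
  Closer e z y = C y e z × ¬ C z e y

  closer? : ∀ e → Decidable₂ (Closer e)
  closer? e z y = C? y e z ×-dec ¬? (C? z e y)

  -- Both halves reroute a path from `e`: `y` separates `e` from `x`, and `z` separates `e` from
  -- `y`.
  closer-trans : ∀ e → Transitive (Closer e)
  closer-trans e {z} {y} {x} (cy , ¬cz) (cx , ¬cy) =
    reroute-via ¬cy cy , λ cz → ¬cy (reroute-via ¬cz cz)

  closer-irrefl : ∀ e {x} → ¬ Closer e x x
  closer-irrefl e (c , ¬c) = ¬c c

  farthest : ∀ b {a} T → a ∈ T → ∃ λ y → y ∈ T × (∀ {x} → x ∈ T → ¬ Closer b y x)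
  farthest b = minimal (flip (closer? b)) (λ p q → closer-trans b q p) (closer-irrefl b)

  -- Once e is placed, T holds the candidates for the next place, which are tied
  -- as seen from e, and Z the other elements; every C z with z ∈ Z joins e to all of T.
  record Module (T Z : List A) : Set where
    field
      together : ∀ {z x y} → z ∈ Z → x ∈ T → y ∈ T → C z x y
      outside  : ∀ {y x z} → y ∈ T → x ∈ Z → z ∈ Z → C x y z → C z y x → ⊥
      disjoint : ∀ {x} → x ∈ T → x ∈ Z → ⊥

  -- Let B be the class of b under C y, with y chosen so that B is maximal.
  -- Every r ∈ T outside B then has B as a class too, so B can be discarded:
  -- an element of T ∖ B admissible in the rest is admissible altogether.
  module Discard {T Z : List A} (M : Module T Z) (b y : A) (y≢b : y ≢ b)
    (y-max : ∀ {x} → x ∈ T → x ≢ b → ¬ Closer b y x)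
    (b-outside : ∀ {z} → z ∈ Z → b ∈ Z) where

    open Module M

    far? : Decidable (λ x → ¬ C y b x)
    far? x = ¬? (C? y b x)

    T′ Z′ : List A
    T′ = filter far? T
    Z′ = filter far? Z

    y-far : ¬ C y b y
    y-far c = y≢b (≡-sym (C-self (C-sym c)))

    discard-module : Module T′ Z′
    discard-module = record
      { together = λ z∈ x∈ y∈ → together (proj₁ (∈-filter⁻ far? z∈)) (proj₁ (∈-filter⁻ far? x∈)) (proj₁ (∈-filter⁻ far? y∈))
      ; outside  = λ y∈ x∈ z∈ → outside (proj₁ (∈-filter⁻ far? y∈)) (proj₁ (∈-filter⁻ far? x∈)) (proj₁ (∈-filter⁻ far? z∈))
      ; disjoint = λ x∈T x∈Z → disjoint (proj₁ (∈-filter⁻ far? x∈T)) (proj₁ (∈-filter⁻ far? x∈Z))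
      }

    y-separated : ∀ {r} → r ∈ T → ¬ C y b r → ¬ C r b y
    y-separated r∈T r-far c = y-max r∈T (λ { refl → r-far C-refl }) (c , r-far)

    -- Since `r` separates `b` from `y`, a path from `b` avoiding `r` also avoids `y`, which would
    -- put `s` into B. Together with `near`, this makes B the class of `b` under `C r`.
    separated : ∀ {r s} → r ∈ T → ¬ C y b r → ¬ C y b s → ¬ C r b s
    separated r∈T r-far s-far c = s-far (reroute-via (y-separated r∈T r-far) c)

    near : ∀ {r x} → ¬ C y b r → C y b x → C r b x
    near r-far c = reroute-via r-far c

    mixed : ∀ {r x z} → r ∈ T → ¬ C y b r → x ∈ T ++ Z → z ∈ T ++ Z →
            C y b x → ¬ C y b z → C x r z → C z r x → ⊥
    mixed {r} {x} {z} r∈T r-far x∈ z∈ x-near z-far cx cz with ∈-++⁻ T z∈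
    ... | inj₁ z∈T = separated z∈T z-far r-far (C-trans (near z-far x-near) (C-sym cz))
    ... | inj₂ z∈Z with ∈-++⁻ T x∈
    ...   | inj₂ x∈Z = outside r∈T x∈Z z∈Z cx cz
    -- The pair `b`, `z` would violate `outside` at `x`. That `x`, `r`, `b` is no asteroidal triple
    -- yields `bxz`; that `r` separates `b` from `z` yields `zxb`.
    ...   | inj₁ x∈T = outside x∈T b∈Z z∈Z bxz zxb
      where
      b∈Z : b ∈ Z
      b∈Z = b-outside z∈Z
      rbx : C r b x
      rbx = near r-far x-near
      x≢r : x ≢ r
      x≢r refl = r-far x-near
      ¬xrb : ¬ C x r b
      ¬xrb xrb = x≢r (C-noAT xrb (C-sym rbx) (together b∈Z x∈T r∈T))
      ¬rxz : ¬ C r x z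
      ¬rxz rxz = separated r∈T r-far z-far (C-trans rbx rxz)
      zxb : C z x b
      zxb = reroute-via ¬rxz (C-sym rbx)
      bxz : C b x z
      bxz = C-trans (together b∈Z x∈T r∈T) (reroute-via ¬xrb cx)

    discard-admissible : ∀ {r} → r ∈ T → ¬ C y b r → Admissible (T′ ++ Z′) r → Admissible (T ++ Z) r
    discard-admissible {r} r∈T r-far adm {x} {z} x∈ z∈ cx cz with C? y b x | C? y b z
    ... | yes x-near | yes z-near =
      -- A path through `b` supplies the third side of an asteroidal triple `x`, `r`, `z`.
      C-noAT cx (C-trans (C-sym (near r-far x-near)) (near r-far z-near)) (C-sym cz)
    ... | yes x-near | no z-far = ⊥-elim (mixed r∈T r-far x∈ z∈ x-near z-far cx cz)
    ... | no x-far | yes z-near = ⊥-elim (mixed r∈T r-far z∈ x∈ z-near x-far cz cx)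
    ... | no x-far | no z-far = adm (restrict x∈ x-far) (restrict z∈ z-far) cx cz
      where
      restrict : ∀ {w} → w ∈ T ++ Z → ¬ C y b w → w ∈ T′ ++ Z′
      restrict w∈ w-far with ∈-++⁻ T w∈
      ... | inj₁ w∈T = ∈-++⁺ˡ (∈-filter⁺ far? w∈T w-far)
      ... | inj₂ w∈Z = ∈-++⁺ʳ T′ (∈-filter⁺ far? w∈Z w-far)

    discard-shorter : b ∈ T ++ Z → length T′ + length Z′ < length T + length Z
    discard-shorter b∈ with ∈-++⁻ T b∈
    ... | inj₁ b∈T = +-mono-<-≤ (filter-notAll far? T (Any.map (λ { refl ¬c → ¬c C-refl }) b∈T)) (length-filter far? Z)
    ... | inj₂ b∈Z = +-mono-≤-< (length-filter far? T) (filter-notAll far? Z (Any.map (λ { refl ¬c → ¬c C-refl }) b∈Z))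

  -- Induction on the number of elements. `b` is taken from `Z` whenever `Z` is nonempty, as
  -- `b-outside` demands, and the candidates never run out because the farthest `y` survives the
  -- discarding.
  admissible-member : ∀ k {t} T Z → length T + length Z ≤ k → t ∈ T → Module T Z →
                      ∃ λ y → y ∈ T × Admissible (T ++ Z) y

  admissible-via : ∀ k {t} T Z → length T + length Z ≤ suc k → Module T Z → t ∈ T →
                   ∀ b → b ∈ T ++ Z → t ≢ b → (∀ {z} → z ∈ Z → b ∈ Z) →
                   ∃ λ y → y ∈ T × Admissible (T ++ Z) y
  admissible-via k T Z len M t∈T b b∈ t≢b b-outside
    with farthest b (filter (λ x → ¬? (x ≟ b)) T) (∈-filter⁺ (λ x → ¬? (x ≟ b)) t∈T t≢b)
  ... | y , y∈ , y-max with ∈-filter⁻ (λ x → ¬? (x ≟ b)) {xs = T} y∈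
  ...   | y∈T , y≢b =
    let r , r∈T′ , adm = admissible-member k T′ Z′ (s≤s⁻¹ (≤-trans (discard-shorter b∈) len))
                           (∈-filter⁺ far? y∈T y-far) discard-module
        r∈T , r-far = ∈-filter⁻ far? r∈T′
    in r , r∈T , discard-admissible r∈T r-far adm
    where open Discard M b y y≢b (λ x∈T x≢b → y-max (∈-filter⁺ (λ x → ¬? (x ≟ b)) x∈T x≢b)) b-outside

  admissible-member zero (_ ∷ _) Z () t∈T M
  admissible-member (suc k) {t} T (b ∷ Z) len t∈T M =
    admissible-via k T (b ∷ Z) len M t∈T b (∈-++⁺ʳ T (here refl))
      (λ { refl → Module.disjoint M t∈T (here refl) }) (λ _ → here refl)
  admissible-member (suc k) {b} T [] len b∈T M with Any.any? (λ x → ¬? (x ≟ b)) T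
  ... | yes found = admissible-via k T [] len M (∈-lookup (index found)) b (∈-++⁺ˡ b∈T) (lookup-index found) (λ ())
  ... | no none = b , b∈T , λ {x} x∈ _ _ _ →
        decidable-stable (x ≟ b) (λ x≢b → none (Any.map (λ { refl → x≢b }) ([ id , (λ ()) ]′ (∈-++⁻ T x∈))))

  Convex : List A → Set
  Convex []       = ⊤
  Convex (x ∷ xs) = AllPairs (λ y z → ¬ C y x z) xs × Convex xs

  -- A `Closer e`-minimal `y₀` separates `e` from all of `S`, and so does every element separating
  -- `e` from `y₀`. This leaves room to choose an admissible one among them.
  next : ∀ e {t} S → t ∈ S → (∀ {x} → x ∈ S → x ≢ e) → Admissible S e →
         ∃ λ y → y ∈ S × Admissible S y × (∀ {z} → z ∈ S → ¬ C y e z)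
  next e S t∈S S≢e adm
    with minimal (closer? e) (closer-trans e) (closer-irrefl e) S t∈S
  ... | y₀ , y₀∈S , y₀-min =
    y , y∈S , (λ x∈ z∈ → y-adm (split x∈) (split z∈)) , separates y∈S y-tied
    where
    -- By minimality `C y₀ e z` would entail `C z e y₀`, against the admissibility of `e`.
    ¬y₀ : ∀ {z} → z ∈ S → ¬ C y₀ e z
    ¬y₀ {z} z∈S c = y₀-min z∈S (c , λ c′ → S≢e y₀∈S (adm y₀∈S z∈S c c′))
    tied? : Decidable (λ y → ¬ C y e y₀)
    tied? y = ¬? (C? y e y₀)
    apart? : Decidable (λ y → C y e y₀)
    apart? y = C? y e y₀
    T Z : List A
    T = filter tied? S
    Z = filter apart? S
    separates : ∀ {y z} → y ∈ S → ¬ C y e y₀ → z ∈ S → ¬ C y e z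
    separates y∈S y-tied z∈S c = ¬y₀ z∈S (reroute-via y-tied c)
    joined : ∀ {z x} → z ∈ Z → x ∈ T → C z e x
    joined {z} {x} z∈ x∈ with ∈-filter⁻ apart? {xs = S} z∈ | ∈-filter⁻ tied? {xs = S} x∈
    ... | _ , c | _ , x-tied = [ (λ c′ → contradiction c′ x-tied) , id ]′ (C-reroute x c)
    M : Module T Z
    M = record
      { together = λ z∈ x∈ y∈ → C-trans (C-sym (joined z∈ x∈)) (joined z∈ y∈)
      -- Prefixed with the connections from `e` to `y`, the two paths contradict the admissibility
      -- of `e`.
      ; outside  = λ y∈ x∈ z∈ cx cz →
          S≢e (proj₁ (∈-filter⁻ apart? x∈))
            (adm (proj₁ (∈-filter⁻ apart? x∈)) (proj₁ (∈-filter⁻ apart? z∈))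
              (C-trans (joined x∈ y∈) cx) (C-trans (joined z∈ y∈) cz))
      ; disjoint = λ x∈T x∈Z → proj₂ (∈-filter⁻ tied? {xs = S} x∈T) (proj₂ (∈-filter⁻ apart? {xs = S} x∈Z))
      }
    y₀∈T : y₀ ∈ T
    y₀∈T = ∈-filter⁺ tied? y₀∈S (¬y₀ y₀∈S)
    found = admissible-member _ T Z ≤-refl y₀∈T M
    y = proj₁ found
    y-adm = proj₂ (proj₂ found)
    y∈S : y ∈ S
    y∈S = proj₁ (∈-filter⁻ tied? (proj₁ (proj₂ found)))
    y-tied : ¬ C y e y₀
    y-tied = proj₂ (∈-filter⁻ tied? {xs = S} (proj₁ (proj₂ found)))
    split : ∀ {x} → x ∈ S → x ∈ T ++ Z
    split {x} x∈S with apart? x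
    ... | yes c = ∈-++⁺ʳ T (∈-filter⁺ apart? x∈S c)
    ... | no ¬c = ∈-++⁺ˡ (∈-filter⁺ tied? x∈S ¬c)

  convex-order-from : ∀ k e S → length S ≤ k → e ∈ S → Admissible S e →
    ∃ λ τ → Convex (e ∷ τ) × (∀ {x} → x ∈ S → x ∈ e ∷ τ) × (∀ {x} → x ∈ τ → x ∈ S)
  convex-order-from zero e (_ ∷ _) () e∈S adm
  convex-order-from (suc k) e S len e∈S adm = extend (filter ≢e? S) shorter (∈-filter⁻ ≢e?) split
    where
    ≢e? : Decidable (_≢ e)
    ≢e? x = ¬? (x ≟ e)
    shorter : length (filter ≢e? S) ≤ k
    shorter = s≤s⁻¹ (≤-trans (filter-notAll ≢e? S (Any.map (λ { refl ¬e → ¬e refl }) e∈S)) len)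
    split : ∀ {x} → x ∈ S → x ≡ e ⊎ x ∈ filter ≢e? S
    split {x} x∈S with x ≟ e
    ... | yes x≡e = inj₁ x≡e
    ... | no x≢e = inj₂ (∈-filter⁺ ≢e? x∈S x≢e)
    -- Whatever e reaches avoiding w, y reaches avoiding w too, as y separates e from it.
    separates-from : ∀ {y l} → (∀ {z} → z ∈ l → ¬ C y e z) →
                     AllPairs (λ w z → ¬ C w y z) l → AllPairs (λ w z → ¬ C w e z) l
    separates-from y-sep [] = []
    separates-from {y} y-sep (px ∷ pxs) =
      All.tabulate (λ z∈ c → All.lookup px z∈ (C-trans (C-sym (reaches-y (y-sep (there z∈)) c)) c))
      ∷ separates-from (y-sep ∘ there) pxs
      where
      reaches-y : ∀ {w z} → ¬ C y e z → C w e z → C w e y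
      reaches-y ¬c c = [ (λ c′ → contradiction c′ ¬c) , id ]′ (C-reroute y c)
    extend : ∀ S′ → length S′ ≤ k → (∀ {x} → x ∈ S′ → x ∈ S × x ≢ e) → (∀ {x} → x ∈ S → x ≡ e ⊎ x ∈ S′) →
      ∃ λ τ → Convex (e ∷ τ) × (∀ {x} → x ∈ S → x ∈ e ∷ τ) × (∀ {x} → x ∈ τ → x ∈ S)
    extend [] _ _ S⊆ = [] , ([] , _) , (λ x∈S → [ here , (λ ()) ]′ (S⊆ x∈S)) , λ ()
    extend S′@(_ ∷ _) len′ ⊆S S⊆
      with next e S′ (here refl) (proj₂ ∘ ⊆S) (λ x∈ z∈ → adm (proj₁ (⊆S x∈)) (proj₁ (⊆S z∈)))
    ... | y , y∈S′ , y-adm , y-sep with convex-order-from k y S′ len′ y∈S′ y-adm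
    ...   | τ , (sep , conv) , covers , within =
      y ∷ τ ,
      (All.tabulate (y-sep ∘ within) ∷ separates-from (y-sep ∘ within) sep , sep , conv) ,
      (λ x∈S → [ here , there ∘ covers ]′ (S⊆ x∈S)) ,
      λ { (here refl) → proj₁ (⊆S y∈S′) ; (there x∈τ) → proj₁ (⊆S (within x∈τ)) }

  convex-order : ∀ S → ∃ λ σ → Convex σ × (∀ {x} → x ∈ S → x ∈ σ)
  convex-order [] = [] , _ , id
  convex-order S@(_ ∷ _)
    with admissible-member _ S [] ≤-refl (here refl)
           -- Nothing is placed yet: all of `S` is a candidate and `Z` is empty.
           (record { together = λ () ; outside = λ _ () ; disjoint = λ _ () })
  ... | e , e∈S , adm with convex-order-from _ e S ≤-refl e∈S (λ x∈ z∈ → adm (∈-++⁺ˡ x∈) (∈-++⁺ˡ z∈))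
  ...   | τ , conv , covers , _ = e ∷ τ , conv , covers

  convex-lookup : ∀ σ → Convex σ → ∀ i j k → i Fin.< j → j Fin.< k →
                  ¬ C (lookup σ j) (lookup σ i) (lookup σ k)
  convex-lookup (x ∷ σ) (sep , _) zero (suc j) (suc k) _ j<k = AllPairs-lookup sep j k (s<s⁻¹ j<k)
    where
    AllPairs-lookup : ∀ {R : A → A → Set} {l} → AllPairs R l → ∀ j k → j Fin.< k → R (lookup l j) (lookup l k)
    AllPairs-lookup (px ∷ _)   zero    (suc k) _   = All.lookup px (∈-lookup k)
    AllPairs-lookup (_ ∷ pxs) (suc j) (suc k) j<k = AllPairs-lookup pxs j k (s<s⁻¹ j<k)
  convex-lookup (x ∷ σ) (_ , conv) (suc i) (suc j) (suc k) i<j j<k =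
    convex-lookup σ conv i j k (s<s⁻¹ i<j) (s<s⁻¹ j<k)

-- Paths avoiding a neighbourhood

module Paths {n : ℕ} (G : SimpleGraph n) where

  Path : Fin n → Fin n → Fin n → Set
  Path = PathAvoiding G

  path-head : ∀ {z x y} → Path z x y → ¬ Adj G z x
  path-head (here ¬zx)     = ¬zx
  path-head (step ¬zx _ _) = ¬zx

  path-last : ∀ {z x y} → Path z x y → ¬ Adj G z y
  path-last (here ¬zx)   = ¬zx
  path-last (step _ _ p) = path-last p

  path-trans : ∀ {z x y w} → Path z x y → Path z y w → Path z x w
  path-trans (here _)         q = q
  path-trans (step ¬zx xy p) q = step ¬zx xy (path-trans p q)

  path-sym : ∀ {z x y} → Path z x y → Path z y x
  path-sym (here ¬zx)      = here ¬zx
  path-sym (step ¬zx xy p) = path-trans (path-sym p) (step (path-head p) (sym G xy) (here ¬zx))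

  path-self : ∀ {y z} → Path y y z → z ≡ y
  path-self (here _)      = refl
  path-self (step _ yx p) = contradiction yx (path-head p)

  -- Follow the path to its first neighbour of `w`, if there is one, and step from there to `w`.
  path-reroute : ∀ {y x z w} → ¬ Adj G y w → Path y x z → Path w x z ⊎ Path y x w
  path-reroute {x = x} {w = w} ¬yw p with dec G w x
  ... | yes wx = inj₂ (step (path-head p) (sym G wx) (here ¬yw))
  path-reroute ¬yw (here _)         | no ¬wx = inj₁ (here ¬wx)
  path-reroute ¬yw (step ¬yx xu p) | no ¬wx = Sum.map (step ¬wx xu) (step ¬yx xu) (path-reroute ¬yw p)

  -- Reach z l: connected by a walk avoiding N(z) with inner vertices in l (Floyd–Warshall).
  Reach : Fin n → List (Fin n) → Fin n → Fin n → Set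
  Reach z []      x y = x ≡ y ⊎ (Adj G x y × ¬ Adj G z x × ¬ Adj G z y)
  Reach z (v ∷ l) x y = Reach z l x y ⊎ (Reach z l x v × Reach z l v y)

  reach? : ∀ z l x y → Dec (Reach z l x y)
  reach? z []      x y = x Fin.≟ y ⊎-dec (dec G x y ×-dec ¬? (dec G z x) ×-dec ¬? (dec G z y))
  reach? z (v ∷ l) x y = reach? z l x y ⊎-dec (reach? z l x v ×-dec reach? z l v y)

  reach-base : ∀ {z} l {x y} → Reach z [] x y → Reach z l x y
  reach-base []      p = p
  reach-base (v ∷ l) p = inj₁ (reach-base l p)

  -- When both walks visit the same head vertex, the loop between the two visits is cut out.
  reach-trans : ∀ {z} l {x v y} → v ∈ l → Reach z l x v → Reach z l v y → Reach z l x y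
  reach-trans (a ∷ l) (here refl) p q = inj₂ ([ id , proj₁ ]′ p , [ id , proj₂ ]′ q)
  reach-trans (a ∷ l) (there v∈) (inj₁ p)        (inj₁ q)        = inj₁ (reach-trans l v∈ p q)
  reach-trans (a ∷ l) (there v∈) (inj₁ p)        (inj₂ (q , q′)) = inj₂ (reach-trans l v∈ p q , q′)
  reach-trans (a ∷ l) (there v∈) (inj₂ (p , p′)) (inj₁ q)        = inj₂ (p , reach-trans l v∈ p′ q)
  reach-trans (a ∷ l) (there v∈) (inj₂ (p , _))  (inj₂ (_ , q))  = inj₂ (p , q)

  reach⇒path : ∀ {z} l {x y} → ¬ Adj G z x → Reach z l x y → Path z x y
  reach⇒path []      ¬zx (inj₁ refl)         = here ¬zx
  reach⇒path []      ¬zx (inj₂ (xy , _ , ¬zy)) = step ¬zx xy (here ¬zy)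
  reach⇒path (v ∷ l) ¬zx (inj₁ p)            = reach⇒path l ¬zx p
  reach⇒path (v ∷ l) ¬zx (inj₂ (p , q))      = path-trans xv (reach⇒path l (path-last xv) q)
    where xv = reach⇒path l ¬zx p

  path⇒reach : ∀ {z x y} → Path z x y → Reach z (allFin n) x y
  path⇒reach (here _)        = reach-base (allFin n) (inj₁ refl)
  path⇒reach (step ¬zx xy p) =
    reach-trans (allFin n) (∈-allFin _) (reach-base (allFin n) (inj₂ (xy , ¬zx , path-head p))) (path⇒reach p)

  path? : ∀ z x y → Dec (Path z x y)
  -- `Reach` is reflexive even at neighbours of `z`, so the start is tested separately.
  path? z x y = map′ (λ (¬zx , p) → reach⇒path (allFin n) ¬zx p) (λ p → path-head p , path⇒reach p)
                     (¬? (dec G z x) ×-dec reach? z (allFin n) x y)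

-- Interval supergraphs

Meets : Interval → Interval → Set
Meets I J = lo I ≤ hi J × lo J ≤ hi I

threshold : ∀ {m} {Q : Fin m → Set} → Decidable Q → (∀ {i j} → i Fin.< j → Q j → Q i) →
            ∃ λ N → N ≤ m × (∀ {i} → Q i → toℕ i < N) × (∀ {i} → toℕ i < N → Q i)
threshold {zero} Q? down = 0 , z≤n , (λ { {()} }) , λ ()
threshold {suc m} {Q} Q? down with Q? zero
... | no ¬q = 0 , z≤n , (λ { {zero} q → contradiction q ¬q ; {suc i} q → contradiction (down z<s q) ¬q }) , λ ()
... | yes q with threshold (Q? ∘ suc) (down ∘ s<s)
...   | N , N≤m , below , above =
  suc N , s≤s N≤m , (λ { {zero} _ → z<s ; {suc i} q → s<s (below q) }) ,
  λ { {zero} _ → q ; {suc i} i<N → above (s<s⁻¹ i<N) }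

module ConvexIntervals {n : ℕ} (G : SimpleGraph n) {m : ℕ} (s : Fin m → Fin n)
  (s-indep : ∀ i j → ¬ Adj G (s i) (s j))
  (s-convex : ∀ i j k → i Fin.< j → j Fin.< k → ¬ PathAvoiding G (s j) (s i) (s k))
  where

  open Paths G

  -- Records the side on which `v` lies when it is not adjacent to `s i`. A `v` connected to no
  -- later member counts as left.
  RightOf : Fin n → Fin m → Set
  RightOf v i = ∃ λ j → i Fin.< j × Path (s i) v (s j)

  NotLeftOf : Fin n → Fin m → Set
  NotLeftOf v i = RightOf v i ⊎ Adj G (s i) v

  rightOf? : ∀ v → Decidable (RightOf v)
  rightOf? v i = any? (λ j → i Fin.<? j ×-dec path? (s i) v (s j))

  notLeftOf? : ∀ v → Decidable (NotLeftOf v)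
  notLeftOf? v i = rightOf? v i ⊎-dec dec G (s i) v

  rightOf⇒¬adj : ∀ {v i} → RightOf v i → ¬ Adj G (s i) v
  rightOf⇒¬adj (_ , _ , p) = path-head p

  -- If the path from `v` to `s k` met the neighbourhood of `s i`, then `s i` and `s k` would be
  -- connected avoiding `s j`, against convexity.
  rightOf-down : ∀ {v i j} → i Fin.< j → RightOf v j → RightOf v i
  rightOf-down {i = i} {j} i<j (k , j<k , p) with path-reroute (s-indep j i) p
  ... | inj₁ q = k , <-trans i<j j<k , q
  ... | inj₂ q = contradiction (path-trans (path-sym q) p) (s-convex i j k i<j j<k)

  notLeftOf-down : ∀ {v i j} → i Fin.< j → NotLeftOf v j → NotLeftOf v i
  notLeftOf-down i<j (inj₁ r) = inj₁ (rightOf-down i<j r)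
  notLeftOf-down {v} {i} {j} i<j (inj₂ jv) with dec G (s i) v
  ... | yes iv = inj₂ iv
  ... | no ¬iv = inj₁ (j , i<j , step ¬iv (sym G jv) (here (s-indep i j)))

  rightOf-adj : ∀ {v w i} → Adj G v w → RightOf v i → NotLeftOf w i
  rightOf-adj {w = w} {i} vw (j , i<j , p) with dec G (s i) w
  ... | yes iw = inj₂ iw
  ... | no ¬iw = inj₁ (j , i<j , step ¬iw (sym G vw) p)

  left : ∀ v → ∃ λ N → N ≤ m × (∀ {i} → RightOf v i → toℕ i < N) × (∀ {i} → toℕ i < N → RightOf v i)
  left v = threshold (rightOf? v) rightOf-down

  right : ∀ v → ∃ λ N → N ≤ m × (∀ {i} → NotLeftOf v i → toℕ i < N) × (∀ {i} → toℕ i < N → NotLeftOf v i)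
  right v = threshold (notLeftOf? v) notLeftOf-down

  left≤right : ∀ v w → (∀ {i} → RightOf v i → NotLeftOf w i) → proj₁ (left v) ≤ proj₁ (right w)
  left≤right v w imp with left v | right w
  ... | L , L≤m , _ , aboveL | H , _ , belowH , _ = ≮⇒≥ λ H<L →
    let H<m = ≤-trans H<L L≤m
        eq  = toℕ-fromℕ< H<m
    in <-irrefl eq (belowH (imp (aboveL (subst (_< L) (≡-sym eq) H<L))))

  -- With even ends 2L and 2R, the interval contains the odd point 2i + 1 exactly when L ≤ i < R,
  -- that is, when `v` is neither right nor left of `s i`, hence adjacent to it.
  interval : ∀ v → Dec (∃ λ i → s i ≡ v) → Interval
  interval v (yes (i , _)) = [ suc (2 * toℕ i) , suc (2 * toℕ i) ]⟨ ≤-refl ⟩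
  interval v (no _)        = [ 2 * proj₁ (left v) , 2 * proj₁ (right v) ]⟨ *-monoʳ-≤ 2 (left≤right v v inj₁) ⟩

  2*suc : ∀ {i N} → i < N → suc (suc (2 * i)) ≤ 2 * N
  2*suc {i} {N} i<N = subst (_≤ 2 * N) (*-suc 2 i) (*-monoʳ-≤ 2 i<N)

  meets-point : ∀ i v d ¬d → Adj G (s i) v → Meets (interval (s i) (yes (i , d))) (interval v (no ¬d))
  meets-point i v _ _ iv =
    <⇒≤ (2*suc (proj₁ (proj₂ (proj₂ (right v))) (inj₂ iv))) ,
    m≤n⇒m≤1+n (*-monoʳ-≤ 2 (≮⇒≥ λ i<L → rightOf⇒¬adj (proj₂ (proj₂ (proj₂ (left v))) i<L) iv))

  interval-meets : ∀ u v du dv → Adj G u v → Meets (interval u du) (interval v dv)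
  interval-meets u v (yes (i , refl)) (yes (j , refl)) uv = contradiction uv (s-indep i j)
  interval-meets u v (yes (i , refl)) (no ¬dv)         uv = meets-point i v refl ¬dv uv
  interval-meets u v (no ¬du)         (yes (j , refl)) uv = swap (meets-point j u refl ¬du (sym G uv))
  interval-meets u v (no _)           (no _)           uv =
    *-monoʳ-≤ 2 (left≤right u v (rightOf-adj uv)) , *-monoʳ-≤ 2 (left≤right v u (rightOf-adj (sym G uv)))

  meets-interval : ∀ i v du dv → s i ≢ v → Meets (interval (s i) du) (interval v dv) → Adj G (s i) v
  meets-interval i v (no ¬du) _ _ _ = contradiction (i , refl) ¬du
  meets-interval i v (yes (i′ , eq)) (yes (j , refl)) si≢v (p , q) =
    contradiction (trans (≡-sym eq) (cong s (toℕ-injective (*-cancelˡ-≡ _ _ 2 (suc-injective (≤-antisym p q)))))) si≢v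
  -- The recorded index `i′` may differ from `i`, since `s` is not assumed injective; only
  -- `s i′ ≡ s i` is used.
  meets-interval i v (yes (i′ , eq)) (no _) _ (p , q)
    with proj₂ (proj₂ (proj₂ (right v))) {i′} (*-cancelˡ-< 2 _ _ p)
  ... | inj₂ i′v = subst (λ x → Adj G x v) eq i′v
  ... | inj₁ r = contradiction (2*suc (proj₁ (proj₂ (proj₂ (left v))) r)) (≤⇒≯ q)

-- Colour classes

module ColourClass {n : ℕ} (G : SimpleGraph n) (atfree : ATFree G)
  {k : ℕ} (c : Fin n → Fin k) (proper : ProperColouring G k c) (a : Fin k) where

  open Paths G

  Class : Set
  Class = ∃ λ v → c v ≡ a

  class-≡ : {x y : Class} → proj₁ x ≡ proj₁ y → x ≡ y
  class-≡ {_ , refl} {_ , refl} refl = refl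

  indep : (x y : Class) → ¬ Adj G (proj₁ x) (proj₁ y)
  indep (x , cx) (y , cy) xy = proper x y xy (trans cx (≡-sym cy))

  C : Class → Class → Class → Set
  C y x z = Path (proj₁ y) (proj₁ x) (proj₁ z)

  noAT : ∀ {x y z} → C x y z → C y x z → C z x y → x ≡ y
  noAT {x} {y} {z} cx cy cz with proj₁ x Fin.≟ proj₁ y
  ... | yes x≡y = class-≡ x≡y
  ... | no x≢y = contradiction
    ((x≢y , y≢z , x≢z , indep x y , indep y z , indep x z) , cz , cx , cy) (atfree _ _ _)
    where
    y≢z : proj₁ y ≢ proj₁ z
    y≢z refl = x≢y (path-self (path-sym cy))
    x≢z : proj₁ x ≢ proj₁ z
    x≢z refl = x≢y (≡-sym (path-self (path-sym cx)))

  open Separation {Class} (λ x y → map′ class-≡ (cong proj₁) (proj₁ x Fin.≟ proj₁ y))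
    C (λ _ _ _ → path? _ _ _) (λ {y} {x} → here (indep y x)) path-sym path-trans
    (class-≡ ∘ path-self) (λ {y} w → path-reroute (indep y w)) (λ {x} {y} {z} → noAT {x} {y} {z})
    using (convex-order; convex-lookup)

  members : List (Fin n) → List Class
  members []      = []
  members (v ∷ l) with c v Fin.≟ a
  ... | yes cv = (v , cv) ∷ members l
  ... | no _   = members l

  ∈-members : ∀ {x : Class} {l} → proj₁ x ∈ l → x ∈ members l
  ∈-members {x , cx} {v ∷ l} x∈ with c v Fin.≟ a | x∈
  ... | yes _  | here refl = here (class-≡ refl)
  ... | no ¬cv | here refl = contradiction cx ¬cv
  ... | yes _  | there x∈l = there (∈-members x∈l)
  ... | no _   | there x∈l = ∈-members x∈l

  class-intervals : ∃ λ (f : Fin n → Interval) →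
    (∀ u v → Adj G u v → Meets (f u) (f v)) ×
    (∀ u v → c u ≡ a → u ≢ v → Meets (f u) (f v) → Adj G u v)
  class-intervals with convex-order (members (allFin n))
  ... | σ , conv , covers =
    (λ v → interval v (in? v)) ,
    (λ u v → interval-meets u v (in? u) (in? v)) ,
    λ u v cu → from-class u v (in-σ u cu)
    where
    s : Fin (length σ) → Fin n
    s = proj₁ ∘ lookup σ
    open ConvexIntervals G s (λ i j → indep (lookup σ i) (lookup σ j)) (convex-lookup σ conv)
    in? : ∀ v → Dec (∃ λ i → s i ≡ v)
    in? v = any? (λ i → s i Fin.≟ v)
    in-σ : ∀ u → c u ≡ a → ∃ λ i → s i ≡ u
    in-σ u cu = index u∈σ , ≡-sym (cong proj₁ (lookup-index u∈σ))
      where u∈σ = covers (∈-members {u , cu} (∈-allFin u))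
    from-class : ∀ u v → (∃ λ i → s i ≡ u) → u ≢ v →
                 Meets (interval u (in? u)) (interval v (in? v)) → Adj G u v
    from-class _ v (i , refl) = meets-interval i v (in? (s i)) (in? v)

-- Box representation with one coordinate per colour

theorem4 : (n : ℕ) (G : SimpleGraph n) → ATFree G → (χ : ℕ) → IsChromaticNumber G χ →
    Σ ℕ (λ d → d ≤ χ × HasBoxRepresentation G d)
theorem4 n G atfree χ ((c , proper) , _) = χ , ≤-refl , box , λ u v u≢v →
    -- In each coordinate the larger of the two lower ends is a common point.
    (λ uv → (λ a → lo (box u a) ⊔ lo (box v a)) ,
            (λ a → m≤m⊔n _ _ , ⊔-lub (lo≤hi (box u a)) (proj₂ (meets a u v uv))) ,
            (λ a → m≤n⊔m (lo (box u a)) _ , ⊔-lub (proj₁ (meets a u v uv)) (lo≤hi (box v a)))) ,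
    -- The coordinate of the colour of `u` alone detects every non-neighbour of `u`.
    λ (p , p∈u , p∈v) → adj (c u) u v refl u≢v
      (≤-trans (proj₁ (p∈u (c u))) (proj₂ (p∈v (c u))) , ≤-trans (proj₁ (p∈v (c u))) (proj₂ (p∈u (c u))))
  where
  rep = ColourClass.class-intervals G atfree c proper
  box : Fin n → Box χ
  box v a = proj₁ (rep a) v
  meets = λ a → proj₁ (proj₂ (rep a))
  adj = λ a → proj₂ (proj₂ (rep a))
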